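{- Let $k\ge 1$ and $\delta>0$. For every $\varepsilon>0$ there is $N_0$ such that for every $N\ge N_0$ that is a multiple of $k$ and every collection $\mathcal{A}\subseteq\mathcal{P}(N)$ that is $k$-large in $N$ and upward closed, if $Z$ is a uniformly random $N/k$-element subset of $N=\{0,\dots,N-1\}$, then with probability at least $1-\varepsilon$ there exists $A\subseteq N$ with $|A|<\delta N$ such that $A\cup Z\in\mathcal{A}$.
   Context: A collection $\mathcal{A}\subseteq\mathcal{P}(N)$ is $k$-large in $N$ if for every partition $N=N_0\cup\dots\cup N_{k-1}$ into $k$ pieces there is $i<k$ with $N_i\in\mathcal{A}$. $\mathcal{A}$ is upward closed if $B\in\mathcal{A}$ and $B\subseteq A\subseteq N$ imply $A\in\mathcal{A}$. -}

module Defs where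

open import Data.Bool using (Bool; true; false; _∧_)
open import Data.Nat using (ℕ; zero; suc; _≟_)
import Data.Fin
import Data.Bool
open import Data.Fin using (Fin)
open import Data.Fin.Subset using (Subset; ∣_∣; _∪_; _⊆_)
open import Data.Vec using ([]; _∷_)
open import Data.List using (List; [_]; map; _++_; filter; length)
open import Data.Bool.ListAction using (any)
open import Data.Product using (∃)
open import Data.Integer using (+_)
open import Data.Rational using (ℚ; _/_; _*_)
open import Data.Rational.Properties using (_<?_)
open import Relation.Binary.PropositionalEquality using (_≡_)
open import Relation.Nullary.Decidable using (⌊_⌋)

ℕ→ℚ : ℕ → ℚ
ℕ→ℚ n = + n / 1

allSubsets : (n : ℕ) → List (Subset n)
allSubsets zero = [ [] ]
allSubsets (suc n) = map (false ∷_) (allSubsets n) ++ map (true ∷_) (allSubsets n)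

Collection : ℕ → Set
Collection N = Subset N → Bool

_∈𝒜_ : ∀ {N} → Subset N → Collection N → Set
X ∈𝒜 𝒜 = 𝒜 X ≡ true

-- the i-th piece of the partition given by the colouring f : N → k
piece : ∀ {N k} → (Fin N → Fin k) → Fin k → Subset N
piece {zero} f i = []
piece {suc N} f i = ⌊ f Fin.zero Data.Fin.≟ i ⌋ ∷ piece (λ x → f (Fin.suc x)) i

KLarge : (k N : ℕ) → Collection N → Set
KLarge k N 𝒜 = (f : Fin N → Fin k) → ∃ λ (i : Fin k) → piece f i ∈𝒜 𝒜

UpwardClosed : (N : ℕ) → Collection N → Set
UpwardClosed N 𝒜 = (B A : Subset N) → B ⊆ A → B ∈𝒜 𝒜 → A ∈𝒜 𝒜

goodZ : ∀ {N} → ℚ → Collection N → Subset N → Bool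
goodZ {N} δ 𝒜 Z =
  any (λ A → ⌊ ℕ→ℚ ∣ A ∣ <? (δ * ℕ→ℚ N) ⌋ ∧ 𝒜 (A ∪ Z)) (allSubsets N)

subsetsOfSize : (N m : ℕ) → List (Subset N)
subsetsOfSize N m = filter (λ Z → ∣ Z ∣ ≟ m) (allSubsets N)

goodCount : (N m : ℕ) → ℚ → Collection N → ℕ
goodCount N m δ 𝒜 = length (filter (λ Z → goodZ δ 𝒜 Z Data.Bool.≟ true) (subsetsOfSize N m))

{-# OPTIONS --safe #-}
module Submission where

-- A uniformly random equipartition has a piece in 𝒜 and each piece is a uniformly random
-- m-set, so 𝒜 contains at least 1/k of the m-sets.  Let d Z be the least number of elements
-- to be added to Z to reach 𝒜.  It decreases by at most 1 when an element is added to Z, so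
-- its variance on the m-sets is at most N, by induction on N conditioning on whether the
-- first element lies in Z.  Since d vanishes on a 1/k fraction, its second moment is at most
-- (k + 1) N, and by Chebyshev's inequality d Z ≥ δ N has probability O(1/N).

-- The two blocks of the variance induction are slices of different levels, m and m + 1, over one
-- element fewer, so their means have to be compared. If Z′ is Z with one more element, `true ∷ Z`
-- and `false ∷ Z′` differ by a swap: losing the first element raises d by at most 1, gaining the
-- other lowers it by at most 1. The effects are opposite, so the means differ by at most 1 and each
-- element adds at most 1 to the variance. A small variance does not say where d concentrates. The
-- density of 𝒜 does: on 𝒜 the deviation from the mean μ is μ itself, so μ²/k is at most the
-- variance N and μ² ≤ kN. Adding the variance gives the factor k + 1. Everything is counted in
-- natural numbers: averages are cleared of denominators and every difference is moved to the other
-- side.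

open import Defs

-- Sums over the m-subsets of an n-set, and their variance.

module SliceSums where

  open import Algebra.Properties.CommutativeSemigroup using (interchange)
  open import Data.Nat
  open import Data.Nat.Properties
  open import Data.Nat.Tactic.RingSolver using (solve-∀)
  open import Data.Bool using (true; false)
  open import Data.Fin.Subset using (Subset)
  open import Data.Product using (_×_; _,_)
  open import Data.Sum using (inj₁; inj₂)
  open import Data.Vec using ([]; _∷_)
  open import Function using (_∘_; const)
  open import Relation.Binary.PropositionalEquality

  -- The recursion is Pascal's rule, so conditioning on the first element holds by computation;
  -- `sum-allSubsets` identifies the result with the filtered list of the statement.
  ∑slice : (n m : ℕ) → (Subset n → ℕ) → ℕ
  ∑slice zero    zero    f = f []
  ∑slice zero    (suc m) f = 0
  ∑slice (suc n) zero    f = ∑slice n zero (f ∘ (false ∷_))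
  ∑slice (suc n) (suc m) f =
    ∑slice n (suc m) (f ∘ (false ∷_)) + ∑slice n m (f ∘ (true ∷_))

  slice-size : (n m : ℕ) → ℕ
  slice-size n m = ∑slice n m (const 1)

  ∑slice-mono : ∀ n m {f g} → (∀ Z → f Z ≤ g Z) → ∑slice n m f ≤ ∑slice n m g
  ∑slice-mono zero    zero    f≤g = f≤g []
  ∑slice-mono zero    (suc m) f≤g = z≤n
  ∑slice-mono (suc n) zero    f≤g = ∑slice-mono n zero (f≤g ∘ _)
  ∑slice-mono (suc n) (suc m) f≤g =
    +-mono-≤ (∑slice-mono n (suc m) (f≤g ∘ _)) (∑slice-mono n m (f≤g ∘ _))

  ∑slice-cong : ∀ n m {f g} → (∀ Z → f Z ≡ g Z) → ∑slice n m f ≡ ∑slice n m g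
  ∑slice-cong n m f≡g = ≤-antisym
    (∑slice-mono n m (≤-reflexive ∘ f≡g)) (∑slice-mono n m (≤-reflexive ∘ sym ∘ f≡g))

  ∑slice-+ : ∀ n m f g → ∑slice n m (λ Z → f Z + g Z) ≡ ∑slice n m f + ∑slice n m g
  ∑slice-+ zero    zero    f g = refl
  ∑slice-+ zero    (suc m) f g = refl
  ∑slice-+ (suc n) zero    f g = ∑slice-+ n zero _ _
  ∑slice-+ (suc n) (suc m) f g =
    trans (cong₂ _+_ (∑slice-+ n (suc m) _ _) (∑slice-+ n m _ _))
          (interchange +-commutativeSemigroup (∑slice n (suc m) _) _ _ _)

  ∑slice-* : ∀ n m c f → ∑slice n m (λ Z → c * f Z) ≡ c * ∑slice n m f
  ∑slice-* zero    zero    c f = refl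
  ∑slice-* zero    (suc m) c f = sym (*-zeroʳ c)
  ∑slice-* (suc n) zero    c f = ∑slice-* n zero c _
  ∑slice-* (suc n) (suc m) c f =
    trans (cong₂ _+_ (∑slice-* n (suc m) c _) (∑slice-* n m c _)) (sym (*-distribˡ-+ c _ _))

  ∑slice-const : ∀ n m c → ∑slice n m (const c) ≡ c * slice-size n m
  ∑slice-const n m c =
    trans (∑slice-cong n m (λ _ → sym (*-identityʳ c))) (∑slice-* n m c (const 1))

  -- A slice with m > n is empty and its size cannot be cancelled. This settles those cases in the
  -- variance and second moment bounds.
  slice-size≡0⇒∑slice≡0 : ∀ n m f → slice-size n m ≡ 0 → ∑slice n m f ≡ 0
  slice-size≡0⇒∑slice≡0 zero    (suc m) f eq = refl
  slice-size≡0⇒∑slice≡0 (suc n) zero    f eq = slice-size≡0⇒∑slice≡0 n zero _ eq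
  slice-size≡0⇒∑slice≡0 (suc n) (suc m) f eq = cong₂ _+_
    (slice-size≡0⇒∑slice≡0 n (suc m) _ (m+n≡0⇒m≡0 _ eq))
    (slice-size≡0⇒∑slice≡0 n m _ (m+n≡0⇒n≡0 (slice-size n (suc m)) eq))

  -- The constructors follow the recursion of `∑slice`: `here` crosses from the block without the
  -- first element to the block with it, `there` stays inside a block.
  infix 4 _⋖_

  data _⋖_ : ∀ {n} → Subset n → Subset n → Set where
    here  : ∀ {n} {Z : Subset n} → false ∷ Z ⋖ true ∷ Z
    there : ∀ {n b} {Z Z′ : Subset n} → Z ⋖ Z′ → b ∷ Z ⋖ b ∷ Z′

  private
    split : ∀ n x y → suc n * (x + y) ≡ n * x + n * y + y + x
    split = solve-∀
    merge : ∀ m x y z w → suc m * x + suc (suc m) * z + (m * y + suc m * w) + y + w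
                        ≡ suc m * (x + y) + suc (suc m) * (z + w)
    merge = solve-∀

  -- The next two lemmas count the covers Z ⋖ Z′ with |Z| = m: each Z lies below n − m
  -- sets and each Z′ lies above m + 1; the term m * _ is moved to avoid subtraction.
  ∑slice-lower≤upper : ∀ n m f g → (∀ {Z Z′} → Z ⋖ Z′ → f Z ≤ g Z′) →
    n * ∑slice n m f ≤ m * ∑slice n m f + suc m * ∑slice n (suc m) g
  ∑slice-lower≤upper zero    m       f g f≤g = z≤n
  ∑slice-lower≤upper (suc n) zero    f g f≤g =
    ≤-trans (+-mono-≤ (∑slice-mono n 0 (λ _ → f≤g here))
                      (∑slice-lower≤upper n 0 _ _ (f≤g ∘ there)))
            (≤-reflexive (rearrange (∑slice n 0 _) (∑slice n 1 _)))
    where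
    rearrange : ∀ x y → x + (y + 0) ≡ y + x + 0
    rearrange = solve-∀
  ∑slice-lower≤upper (suc n) (suc m) f g f≤g = begin
    suc n * (f₀ + f₁)                                            ≡⟨ split n f₀ f₁ ⟩
    n * f₀ + n * f₁ + f₁ + f₀                                    ≤⟨ +-mono-≤ (+-mono-≤ (+-mono-≤
        (∑slice-lower≤upper n (suc m) _ _ (f≤g ∘ there))
        (∑slice-lower≤upper n m _ _ (f≤g ∘ there))) ≤-refl)
        (∑slice-mono n (suc m) (λ _ → f≤g here)) ⟩
    suc m * f₀ + suc (suc m) * g₀ + (m * f₁ + suc m * g₁) + f₁ + g₁ ≡⟨ merge m f₀ f₁ g₀ g₁ ⟩
    suc m * (f₀ + f₁) + suc (suc m) * (g₀ + g₁)                  ∎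
    where
    open ≤-Reasoning
    f₀ = ∑slice n (suc m) (f ∘ (false ∷_))
    f₁ = ∑slice n m (f ∘ (true ∷_))
    g₀ = ∑slice n (suc (suc m)) (g ∘ (false ∷_))
    g₁ = ∑slice n (suc m) (g ∘ (true ∷_))

  ∑slice-upper≤lower : ∀ n m f g → (∀ {Z Z′} → Z ⋖ Z′ → g Z′ ≤ f Z) →
    m * ∑slice n m f + suc m * ∑slice n (suc m) g ≤ n * ∑slice n m f
  ∑slice-upper≤lower zero    zero    f g g≤f = z≤n
  ∑slice-upper≤lower zero    (suc m) f g g≤f =
    ≤-reflexive (cong₂ _+_ (*-zeroʳ m) (*-zeroʳ m))
  ∑slice-upper≤lower (suc n) zero    f g g≤f =
    ≤-trans (≤-reflexive (rearrange (∑slice n 1 _) (∑slice n 0 _)))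
            (+-mono-≤ (∑slice-mono n 0 (λ _ → g≤f here))
                      (∑slice-upper≤lower n 0 _ _ (g≤f ∘ there)))
    where
    rearrange : ∀ y x → y + x + 0 ≡ x + (y + 0)
    rearrange = solve-∀
  ∑slice-upper≤lower (suc n) (suc m) f g g≤f = begin
    suc m * (f₀ + f₁) + suc (suc m) * (g₀ + g₁)                  ≡⟨ merge m f₀ f₁ g₀ g₁ ⟨
    suc m * f₀ + suc (suc m) * g₀ + (m * f₁ + suc m * g₁) + f₁ + g₁ ≤⟨ +-mono-≤ (+-mono-≤ (+-mono-≤
        (∑slice-upper≤lower n (suc m) _ _ (g≤f ∘ there))
        (∑slice-upper≤lower n m _ _ (g≤f ∘ there))) ≤-refl)
        (∑slice-mono n (suc m) (λ _ → g≤f here)) ⟩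
    n * f₀ + n * f₁ + f₁ + f₀                                    ≡⟨ split n f₀ f₁ ⟨
    suc n * (f₀ + f₁)                                            ∎
    where
    open ≤-Reasoning
    f₀ = ∑slice n (suc m) (f ∘ (false ∷_))
    f₁ = ∑slice n m (f ∘ (true ∷_))
    g₀ = ∑slice n (suc (suc m)) (g ∘ (false ∷_))
    g₁ = ∑slice n (suc m) (g ∘ (true ∷_))

  -- For constant functions both double counts apply, which gives (n - m) C(n, m) = (m + 1) C(n, m +
  -- 1).
  slice-size-suc : ∀ n m →
    n * slice-size n m ≡ m * slice-size n m + suc m * slice-size n (suc m)
  slice-size-suc n m = ≤-antisym
    (∑slice-lower≤upper n m _ _ (λ _ → ≤-refl)) (∑slice-upper≤lower n m _ _ (λ _ → ≤-refl))

  private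
    distribute : ∀ m a b s → (m * a + suc m * b) * s ≡ m * a * s + suc m * (b * s)
    distribute = solve-∀
    swap : ∀ n a s → n * a * s ≡ a * (n * s)
    swap = solve-∀
    expand : ∀ m a s t → a * (m * s + suc m * t) ≡ m * a * s + suc m * (a * t)
    expand = solve-∀

  -- A uniform m-set with a uniform new element is a uniform (m + 1)-set, so a comparison along
  -- covers passes to the averages. The term `m * a * s` is added to both sides to let
  -- `slice-size-suc` be substituted.
  ∑slice-average-lower≤upper : ∀ n m f g → (∀ {Z Z′} → Z ⋖ Z′ → f Z ≤ g Z′) →
    slice-size n (suc m) * ∑slice n m f ≤ slice-size n m * ∑slice n (suc m) g
  ∑slice-average-lower≤upper n m f g f≤g =
    *-cancelˡ-≤ (suc m) (+-cancelˡ-≤ (m * a * s) _ _ (begin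
      m * a * s + suc m * (b * s)   ≡⟨ distribute m a b s ⟨
      (m * a + suc m * b) * s       ≡⟨ cong (_* s) (slice-size-suc n m) ⟨
      n * a * s                     ≡⟨ swap n a s ⟩
      a * (n * s)                   ≤⟨ *-monoʳ-≤ a (∑slice-lower≤upper n m f g f≤g) ⟩
      a * (m * s + suc m * t)       ≡⟨ expand m a s t ⟩
      m * a * s + suc m * (a * t)   ∎))
    where
    open ≤-Reasoning
    a = slice-size n m
    b = slice-size n (suc m)
    s = ∑slice n m f
    t = ∑slice n (suc m) g

  ∑slice-average-upper≤lower : ∀ n m f g → (∀ {Z Z′} → Z ⋖ Z′ → g Z′ ≤ f Z) →
    slice-size n m * ∑slice n (suc m) g ≤ slice-size n (suc m) * ∑slice n m f
  ∑slice-average-upper≤lower n m f g g≤f =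
    *-cancelˡ-≤ (suc m) (+-cancelˡ-≤ (m * a * s) _ _ (begin
      m * a * s + suc m * (a * t)   ≡⟨ expand m a s t ⟨
      a * (m * s + suc m * t)       ≤⟨ *-monoʳ-≤ a (∑slice-upper≤lower n m f g g≤f) ⟩
      a * (n * s)                   ≡⟨ swap n a s ⟨
      n * a * s                     ≡⟨ cong (_* s) (slice-size-suc n m) ⟩
      (m * a + suc m * b) * s       ≡⟨ distribute m a b s ⟩
      m * a * s + suc m * (b * s)   ∎))
    where
    open ≤-Reasoning
    a = slice-size n m
    b = slice-size n (suc m)
    s = ∑slice n m f
    t = ∑slice n (suc m) g

  private
    square-diff : ∀ {x y d} → x ≤ y → y ≤ x + d → x * x + y * y ≤ 2 * (x * y) + d * d
    square-diff {x} {d = d} x≤y y≤x+d with m≤n⇒∃[o]m+o≡n x≤y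
    ... | e , refl = ≤-trans (≤-reflexive (identity x e))
      (+-monoʳ-≤ (2 * (x * (x + e))) (*-mono-≤ e≤d e≤d))
      where
      identity : ∀ x e → x * x + (x + e) * (x + e) ≡ 2 * (x * (x + e)) + e * e
      identity = solve-∀
      e≤d : e ≤ d
      e≤d = +-cancelˡ-≤ x e d y≤x+d

    2xy≤x²+y²-ordered : ∀ {x y} → x ≤ y → 2 * (x * y) ≤ x * x + y * y
    2xy≤x²+y²-ordered {x} x≤y with m≤n⇒∃[o]m+o≡n x≤y
    ... | e , refl = ≤-trans (m≤m+n _ (e * e)) (≤-reflexive (identity x e))
      where
      identity : ∀ x e → 2 * (x * (x + e)) + e * e ≡ x * x + (x + e) * (x + e)
      identity = solve-∀

  x²+y²≤2xy+d² : ∀ {x y d} → x ≤ y + d → y ≤ x + d → x * x + y * y ≤ 2 * (x * y) + d * d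
  x²+y²≤2xy+d² {x} {y} {d} x≤y+d y≤x+d with ≤-total x y
  ... | inj₁ x≤y = square-diff x≤y y≤x+d
  ... | inj₂ y≤x = subst₂ _≤_ (+-comm (y * y) (x * x)) (cong (λ z → 2 * z + d * d) (*-comm y x))
                     (square-diff y≤x x≤y+d)

  2xy≤x²+y² : ∀ x y → 2 * (x * y) ≤ x * x + y * y
  2xy≤x²+y² x y with ≤-total x y
  ... | inj₁ x≤y = 2xy≤x²+y²-ordered x≤y
  ... | inj₂ y≤x = subst₂ _≤_ (cong (2 *_) (*-comm y x)) (+-comm (y * y) (x * x))
                     (2xy≤x²+y²-ordered y≤x)

  -- The law of total variance for the union of two blocks of sizes a and b whose means
  -- differ by at most 1, with denominators cleared.
  variance-of-union : ∀ n a b s t p q →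
    (a ≡ 0 → s ≡ 0 × p ≡ 0) → (b ≡ 0 → t ≡ 0 × q ≡ 0) →
    a * p ≤ s * s + n * (a * a) → b * q ≤ t * t + n * (b * b) →
    b * s ≤ a * t + a * b → a * t ≤ b * s + a * b →
    (b + a) * (q + p) ≤ (t + s) * (t + s) + suc n * ((b + a) * (b + a))
  variance-of-union n zero b s t p q a0 _ _ hb _ _ with a0 refl
  ... | refl , refl rewrite +-identityʳ b | +-identityʳ q | +-identityʳ t =
    ≤-trans hb (+-monoʳ-≤ (t * t) (m≤n+m _ (b * b)))
  variance-of-union n a@(suc _) zero s t p q _ b0 ha _ _ _ with b0 refl
  ... | refl , refl = ≤-trans ha (+-monoʳ-≤ (s * s) (m≤n+m _ (a * a)))
  variance-of-union n a@(suc _) b@(suc _) s t p q _ _ ha hb s≤t t≤s = *-cancelˡ-≤ (a * b) (begin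
    a * b * ((b + a) * (q + p))
      ≡⟨ distribute-ab a b p q ⟩
    (b + a) * (a * (b * q) + b * (a * p))
      ≤⟨ *-monoʳ-≤ (b + a) (+-mono-≤ (*-monoʳ-≤ a hb) (*-monoʳ-≤ b ha)) ⟩
    (b + a) * (a * (t * t + n * (b * b)) + b * (s * s + n * (a * a)))
      ≡⟨ isolate n a b s t ⟩
    (b * s * (b * s) + a * t * (a * t)) + (a * b * (s * s + t * t) + a * b * (n * ((b + a) * (b + a))))
      -- The means s/a and t/b differ by at most 1, so b s and a t differ by at most a b.
      ≤⟨ +-monoˡ-≤ _ (x²+y²≤2xy+d² s≤t t≤s) ⟩
    (2 * (b * s * (a * t)) + a * b * (a * b)) + (a * b * (s * s + t * t) + a * b * (n * ((b + a) * (b + a))))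
      ≡⟨ collect n a b s t ⟩
    a * b * (a * b + ((t + s) * (t + s) + n * ((b + a) * (b + a))))
      -- The variance between the blocks, at most ab/(a + b)², is rounded up to 1; this is the unit
      -- that each element contributes.
      ≤⟨ *-monoʳ-≤ (a * b) (+-monoˡ-≤ _ (*-mono-≤ (m≤n+m a b) (m≤m+n b a))) ⟩
    a * b * ((b + a) * (b + a) + ((t + s) * (t + s) + n * ((b + a) * (b + a))))
      ≡⟨ regroup n (a * b) ((b + a) * (b + a)) ((t + s) * (t + s)) ⟩
    a * b * ((t + s) * (t + s) + suc n * ((b + a) * (b + a))) ∎)
    where
    open ≤-Reasoning
    distribute-ab : ∀ a b p q → a * b * ((b + a) * (q + p)) ≡ (b + a) * (a * (b * q) + b * (a * p))
    distribute-ab = solve-∀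
    isolate : ∀ n a b s t → (b + a) * (a * (t * t + n * (b * b)) + b * (s * s + n * (a * a)))
      ≡ (b * s * (b * s) + a * t * (a * t)) + (a * b * (s * s + t * t) + a * b * (n * ((b + a) * (b + a))))
    isolate = solve-∀
    collect : ∀ n a b s t →
      (2 * (b * s * (a * t)) + a * b * (a * b)) + (a * b * (s * s + t * t) + a * b * (n * ((b + a) * (b + a))))
      ≡ a * b * (a * b + ((t + s) * (t + s) + n * ((b + a) * (b + a))))
    collect = solve-∀
    regroup : ∀ n u v w → u * (v + (w + n * v)) ≡ u * (w + suc n * v)
    regroup = solve-∀

  record SlowlyDecreasing {n} (f : Subset n → ℕ) : Set where
    field
      antitone : ∀ {Z Z′} → Z ⋖ Z′ → f Z′ ≤ f Z
      slow     : ∀ {Z Z′} → Z ⋖ Z′ → f Z ≤ suc (f Z′)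

  restrict : ∀ {n} {f : Subset (suc n) → ℕ} b → SlowlyDecreasing f → SlowlyDecreasing (f ∘ (b ∷_))
  restrict b f↘ = record { antitone = antitone ∘ there ; slow = slow ∘ there }
    where open SlowlyDecreasing f↘

  ∑slice-variance : ∀ n m f → SlowlyDecreasing f →
    slice-size n m * ∑slice n m (λ Z → f Z * f Z)
      ≤ ∑slice n m f * ∑slice n m f + n * (slice-size n m * slice-size n m)
  ∑slice-variance zero    zero    f f↘ = ≤-reflexive (trans (*-identityˡ _) (sym (+-identityʳ _)))
  ∑slice-variance zero    (suc m) f f↘ = z≤n
  ∑slice-variance (suc n) zero    f f↘ =
    ≤-trans (∑slice-variance n zero _ (restrict false f↘))
            (+-monoʳ-≤ (∑slice n zero _ * ∑slice n zero _) (m≤n+m _ (slice-size n 0 * slice-size n 0)))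
  ∑slice-variance (suc n) (suc m) f f↘ =
    variance-of-union n a b (∑slice n m f₁) (∑slice n (suc m) f₀) _ _
      (λ a≡0 → slice-size≡0⇒∑slice≡0 n m _ a≡0 , slice-size≡0⇒∑slice≡0 n m _ a≡0)
      (λ b≡0 → slice-size≡0⇒∑slice≡0 n (suc m) _ b≡0 , slice-size≡0⇒∑slice≡0 n (suc m) _ b≡0)
      (∑slice-variance n m _ (restrict true f↘))
      (∑slice-variance n (suc m) _ (restrict false f↘))
      -- The swap from `true ∷ Z` to `false ∷ Z′` passes through `false ∷ Z` here and through
      -- `true ∷ Z′` in the next bound.
      (≤-trans (∑slice-average-lower≤upper n m f₁ (λ Z → f₀ Z + 1)
                  (λ c → ≤-trans (antitone here) (≤-trans (slow (there c)) (≤-reflexive (+-comm 1 _)))))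
               (≤-reflexive (trans (cong (a *_) (∑slice-+ n (suc m) f₀ (const 1))) (*-distribˡ-+ a _ b))))
      (≤-trans (∑slice-average-upper≤lower n m (λ Z → f₁ Z + 1) f₀
                  (λ c → ≤-trans (slow here) (≤-trans (s≤s (antitone (there c))) (≤-reflexive (+-comm 1 _)))))
               (≤-reflexive (trans (cong (b *_) (∑slice-+ n m f₁ (const 1)))
                 (trans (*-distribˡ-+ b _ a) (cong (b * ∑slice n m f₁ +_) (*-comm b a))))))
    where
    open SlowlyDecreasing f↘
    f₀ = f ∘ (false ∷_)
    f₁ = f ∘ (true ∷_)
    a = slice-size n m
    b = slice-size n (suc m)

-- Random equipartitions and the density of a k-large collection.

module Equipartitions where

  import Algebra.Properties.Semiring.Sum as Sum
  open import Data.Nat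
  open import Data.Nat.Properties
  open import Data.Nat.Tactic.RingSolver using (solve-∀)
  open import Data.Bool using (Bool; true; false; if_then_else_)
  open import Data.Fin as Fin using (Fin; zero; suc)
  open import Data.Fin.Subset using (Subset)
  open import Data.Sum using (_⊎_; inj₁; inj₂)
  open import Data.Vec using ([]; _∷_)
  import Data.Vec.Functional as Vector
  open import Data.Vec.Functional using (Vector)
  open import Function using (_∘_; const)
  open import Relation.Binary.PropositionalEquality
  open import Relation.Nullary using (yes; no)
  open import Relation.Nullary.Decidable using (⌊_⌋)
  open SliceSums
  open Sum +-*-semiring

  -- For p ≤ n, the sum of h {π 0, …, π (p − 1)} over all permutations π of n.
  ∑perm : (n p : ℕ) → (Subset n → ℕ) → ℕ
  ∑perm zero    p h = h []
  ∑perm (suc n) p h =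
    p * ∑perm n (pred p) (h ∘ (true ∷_)) + (suc n ∸ p) * ∑perm n p (h ∘ (false ∷_))

  slice-empty : ∀ n p f → n < p → ∑slice n p f ≡ 0
  slice-empty zero    (suc p) f _   = refl
  slice-empty (suc n) (suc p) f n<p =
    cong₂ _+_ (slice-empty n (suc p) _ (m≤n⇒m≤1+n (s<s⁻¹ n<p))) (slice-empty n p _ (s<s⁻¹ n<p))

  -- A given p-set is the image of the first p positions under p! (n - p)! permutations.
  ∑perm≡∑slice : ∀ n p h → p ≤ n → ∑perm n p h ≡ p ! * (n ∸ p) ! * ∑slice n p h
  ∑perm≡∑slice zero    zero    h z≤n = sym (+-identityʳ _)
  ∑perm≡∑slice (suc n) zero    h z≤n = trans
    (cong (suc n *_) (∑perm≡∑slice n 0 _ z≤n))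
    (rearrange n (n !) (∑slice n 0 _))
    where
    rearrange : ∀ n u s → suc n * ((u + 0) * s) ≡ (suc n * u + 0) * s
    rearrange = solve-∀
  ∑perm≡∑slice (suc n) (suc p) h (s≤s p≤n) = trans
    (cong₂ _+_ (cong (suc p *_) (∑perm≡∑slice n p _ p≤n)) without-zero)
    (rearrange p (p !) ((n ∸ p) !) (∑slice n p _) (∑slice n (suc p) _))
    where
    rearrange : ∀ p u v x y → suc p * (u * v * x) + suc p * u * v * y ≡ suc p * u * v * (y + x)
    rearrange = solve-∀
    assoc : ∀ w u v y → w * (u * v * y) ≡ u * (w * v) * y
    assoc = solve-∀
    without-zero : (n ∸ p) * ∑perm n (suc p) (h ∘ (false ∷_))
                 ≡ suc p ! * (n ∸ p) ! * ∑slice n (suc p) (h ∘ (false ∷_))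
    without-zero with m≤n⇒m<n∨m≡n p≤n
    ... | inj₁ p<n rewrite +-∸-assoc 1 p<n = trans
      (cong (suc (n ∸ suc p) *_) (∑perm≡∑slice n (suc p) _ p<n))
      (assoc (suc (n ∸ suc p)) (suc p !) ((n ∸ suc p) !) _)
    -- Here the recursive call falls outside the range p ≤ n, but its factor is 0, and the slice on
    -- the other side is empty.
    ... | inj₂ refl rewrite n∸n≡0 n | slice-empty n (suc n) (h ∘ (false ∷_)) ≤-refl =
      sym (*-zeroʳ (suc n ! * 1))

  ∑perm-1 : ∀ n p → p ≤ n → ∑perm n p (const 1) ≡ n !
  ∑perm-1 zero    p p≤n = refl
  ∑perm-1 (suc n) p p≤n = trans (cong₂ _+_ (chosen p p≤n) (unchosen (m≤n⇒m<n∨m≡n p≤n)))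
    (trans (sym (*-distribʳ-+ (n !) p (suc n ∸ p))) (cong (_* n !) (m+[n∸m]≡n p≤n)))
    where
    chosen : ∀ p → p ≤ suc n → p * ∑perm n (pred p) (const 1) ≡ p * n !
    chosen zero    _         = refl
    chosen (suc p) (s≤s p≤n) = cong (suc p *_) (∑perm-1 n p p≤n)
    unchosen : p < suc n ⊎ p ≡ suc n → (suc n ∸ p) * ∑perm n p (const 1) ≡ (suc n ∸ p) * n !
    unchosen (inj₁ (s≤s p≤n)) = cong ((suc n ∸ p) *_) (∑perm-1 n p p≤n)
    unchosen (inj₂ refl) rewrite n∸n≡0 n = refl

  sum-mono : ∀ {k} (f g : Vector ℕ k) → (∀ i → f i ≤ g i) → sum f ≤ sum g
  sum-mono {zero}  f g f≤g = z≤n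
  sum-mono {suc k} f g f≤g = +-mono-≤ (f≤g zero) (sum-mono (f ∘ suc) (g ∘ suc) (f≤g ∘ suc))

  term≤sum : ∀ {k} (f : Vector ℕ k) i → f i ≤ sum f
  term≤sum f zero    = m≤m+n _ _
  term≤sum f (suc i) = m≤n⇒m≤o+n (f zero) (term≤sum (f ∘ suc) i)

  sum-const : ∀ k c → sum {k} (const c) ≡ k * c
  sum-const zero    c = refl
  sum-const (suc k) c = cong (c +_) (sum-const k c)

  -- The sums differ in entry j alone; adding `y j` on the left replaces a subtraction.
  sum-update : ∀ {k} (x y : Vector ℕ k) j →
    sum (λ i → if ⌊ j Fin.≟ i ⌋ then x i else y i) + y j ≡ x j + sum y
  sum-update {suc k} x y zero = rearrange (x zero) (sum (y ∘ suc)) (y zero)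
    where
    rearrange : ∀ a b c → a + b + c ≡ a + (c + b)
    rearrange = solve-∀
  sum-update {suc k} x y (suc j) = trans
    (cong (λ s → y zero + s + y (suc j)) (sum-cong-≗ (λ i → cong (if_then x (suc i) else y (suc i)) (does-suc i))))
    (trans (+-assoc (y zero) _ _)
      (trans (cong (y zero +_) (sum-update (x ∘ suc) (y ∘ suc) j)) (rearrange (y zero) (x (suc j)) _)))
    where
    does-suc : ∀ i → ⌊ suc j Fin.≟ suc i ⌋ ≡ ⌊ j Fin.≟ i ⌋
    does-suc i with j Fin.≟ i
    ... | yes _ = refl
    ... | no  _ = refl
    rearrange : ∀ a b c → a + (b + c) ≡ b + (a + c)
    rearrange = solve-∀

  -- Conditioning on the colour j of the first element, which a random colouring with
  -- colour counts c takes with probability c j / n, gives the induction on n.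
  partition-average : ∀ n {k} (c : Vector ℕ k) (h : Fin k → Subset n → ℕ) → sum c ≡ n →
    (∀ (f : Fin n → Fin k) → 1 ≤ sum (λ i → h i (piece f i))) →
    n ! ≤ sum (λ i → ∑perm n (c i) (h i))
  partition-average zero    c h sum≡ large = large (λ ())
  -- Adding the sum of `c j * Y j` to both sides completes the factor `suc n ∸ c j` of `Y j` to
  -- `suc n`, which is what summing `conditioned` with weights `c j` produces.
  partition-average (suc n) {k} c h sum≡ large = +-cancelʳ-≤ (sum (λ j → c j * Y j)) _ _ (begin
    suc n * n ! + sum (λ j → c j * Y j)
      ≡⟨ cong (λ s → s * n ! + sum (λ j → c j * Y j)) sum≡ ⟨
    sum c * n ! + sum (λ j → c j * Y j)
      ≡⟨ cong (_+ sum (λ j → c j * Y j)) (*-distribʳ-sum (n !) c) ⟩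
    sum (λ j → c j * n !) + sum (λ j → c j * Y j)
      ≡⟨ ∑-distrib-+ (λ j → c j * n !) (λ j → c j * Y j) ⟨
    sum (λ j → c j * n ! + c j * Y j)
      ≤⟨ sum-mono _ _ first-colour ⟩
    sum (λ j → c j * X j + c j * sum Y)
      ≡⟨ ∑-distrib-+ (λ j → c j * X j) (λ j → c j * sum Y) ⟩
    sum (λ j → c j * X j) + sum (λ j → c j * sum Y)
      ≡⟨ cong (sum (λ j → c j * X j) +_) (*-distribʳ-sum (sum Y) c) ⟨
    sum (λ j → c j * X j) + sum c * sum Y
      ≡⟨ cong (λ s → sum (λ j → c j * X j) + s * sum Y) sum≡ ⟩
    sum (λ j → c j * X j) + suc n * sum Y
      ≡⟨ cong (sum (λ j → c j * X j) +_) (trans (*-distribˡ-sum (suc n) Y) (trans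
           (sum-cong-≗ (λ j → trans (cong (_* Y j) (sym (m∸n+n≡m (c≤ j)))) (*-distribʳ-+ (Y j) (suc n ∸ c j) (c j))))
           (∑-distrib-+ (λ j → (suc n ∸ c j) * Y j) (λ j → c j * Y j)))) ⟩
    sum (λ j → c j * X j) + (sum (λ j → (suc n ∸ c j) * Y j) + sum (λ j → c j * Y j))
      ≡⟨ +-assoc (sum (λ j → c j * X j)) _ _ ⟨
    sum (λ j → c j * X j) + sum (λ j → (suc n ∸ c j) * Y j) + sum (λ j → c j * Y j)
      ≡⟨ cong (_+ sum (λ j → c j * Y j)) (∑-distrib-+ (λ j → c j * X j) (λ j → (suc n ∸ c j) * Y j)) ⟨
    sum (λ j → ∑perm (suc n) (c j) (h j)) + sum (λ j → c j * Y j) ∎)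
    where
    open ≤-Reasoning
    -- Permutation sums for piece i when the first element lies in it (`X`) and when it does not
    -- (`Y`).
    X Y : Vector ℕ k
    X i = ∑perm n (pred (c i)) (h i ∘ (true ∷_))
    Y i = ∑perm n (c i) (h i ∘ (false ∷_))

    c≤ : ∀ j → c j ≤ suc n
    c≤ j = subst (c j ≤_) sum≡ (term≤sum c j)

    lower : Fin k → Vector ℕ k
    lower j i = if ⌊ j Fin.≟ i ⌋ then pred (c i) else c i

    sum-lower : ∀ j → 0 < c j → sum (lower j) ≡ n
    sum-lower j 0<cj = +-cancelʳ-≡ (c j) _ _ (trans (sum-update (pred ∘ c) c j)
      (trans (cong (pred (c j) +_) sum≡) (shift (c j) 0<cj)))
      where
      shift : ∀ p → 0 < p → pred p + suc n ≡ n + p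
      shift (suc p) _ = trans (+-suc p n) (trans (cong suc (+-comm p n)) (sym (+-suc n p)))

    condition : ∀ (b : Bool) i →
      ∑perm n (if b then pred (c i) else c i) (h i ∘ (b ∷_)) ≡ (if b then X i else Y i)
    condition true  i = refl
    condition false i = refl

    conditioned : ∀ j → 0 < c j → n ! + Y j ≤ X j + sum Y
    conditioned j 0<cj = begin
      n ! + Y j
        ≤⟨ +-monoˡ-≤ (Y j) (partition-average n (lower j) (λ i → h i ∘ (⌊ j Fin.≟ i ⌋ ∷_))
             (sum-lower j 0<cj) (λ f → large (j Vector.∷ f))) ⟩
      sum (λ i → ∑perm n (lower j i) (h i ∘ (⌊ j Fin.≟ i ⌋ ∷_))) + Y j
        ≡⟨ cong (_+ Y j) (sum-cong-≗ (λ i → condition ⌊ j Fin.≟ i ⌋ i)) ⟩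
      sum (λ i → if ⌊ j Fin.≟ i ⌋ then X i else Y i) + Y j
        ≡⟨ sum-update X Y j ⟩
      X j + sum Y ∎

    first-colour : ∀ j → c j * n ! + c j * Y j ≤ c j * X j + c j * sum Y
    first-colour j = scale (c j) (conditioned j)
      where
      -- A colour with `c j` equal to 0 has no conditioned estimate, but it also has weight 0.
      scale : ∀ p {u v x y} → (0 < p → u + v ≤ x + y) → p * u + p * v ≤ p * x + p * y
      scale zero    _ = z≤n
      scale (suc p) {u} {v} {x} {y} u+v≤x+y =
        subst₂ _≤_ (*-distribˡ-+ (suc p) u v) (*-distribˡ-+ (suc p) x y) (*-monoʳ-≤ (suc p) (u+v≤x+y z<s))

  -- With all colour counts equal to m, the k pieces contribute the same permutation sum; cancelling
  -- m! (N - m)! leaves a sum over m-sets.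
  equipartition-average : ∀ k m (h : Subset (k * m) → ℕ) → 1 ≤ k →
    (∀ (f : Fin (k * m) → Fin k) → 1 ≤ sum (λ i → h (piece f i))) →
    slice-size (k * m) m ≤ k * ∑slice (k * m) m h
  equipartition-average k m h 1≤k large = *-cancelˡ-≤ w (begin
    w * slice-size N m    ≡⟨ ∑perm≡∑slice N m (const 1) m≤N ⟨
    ∑perm N m (const 1)   ≡⟨ ∑perm-1 N m m≤N ⟩
    N !                   ≤⟨ partition-average N (const m) (const h) (sum-const k m) large ⟩
    sum {k} (const (∑perm N m h)) ≡⟨ sum-const k _ ⟩
    k * ∑perm N m h       ≡⟨ cong (k *_) (∑perm≡∑slice N m h m≤N) ⟩
    k * (w * ∑slice N m h) ≡⟨ swap k w _ ⟩
    w * (k * ∑slice N m h) ∎)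
    where
    open ≤-Reasoning
    N = k * m
    w = m ! * (N ∸ m) !
    instance
      w≢0 : NonZero w
      w≢0 = m*n≢0 (m !) ((N ∸ m) !) {{m !≢0}} {{(N ∸ m) !≢0}}
    m≤N : m ≤ N
    m≤N = subst (_≤ N) (*-identityˡ m) (*-monoˡ-≤ m 1≤k)
    swap : ∀ k w s → k * (w * s) ≡ w * (k * s)
    swap = solve-∀

-- The distance from a set to the collection.

module Distance where

  open import Data.Bool using (true; false; if_then_else_)
  open import Data.Bool.Properties using (T-≡; T-∧)
  open import Data.Fin.Subset using (Subset; ∣_∣; _∪_; ⊤)
  open import Data.Fin.Subset.Properties using (∪-zeroˡ; ∣⊤∣≡n; s⊆s; out⊆; ⊆-refl)
  open import Data.List.Membership.Propositional using (_∈_; lose)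
  open import Data.List.Membership.Propositional.Properties using (∈-++⁺ˡ; ∈-++⁺ʳ; ∈-map⁺)
  open import Data.List.Relation.Unary.Any using (here)
  open import Data.List.Relation.Unary.Any.Properties using (any⁺)
  open import Data.Nat
  open import Data.Nat.Properties
  import Data.Rational as ℚ
  open import Data.Product using (∃; _×_; _,_)
  open import Data.Sum using (_⊎_; inj₁; inj₂)
  open import Data.Vec using ([]; _∷_)
  open import Function using (_∘_; Equivalence)
  open import Relation.Binary.PropositionalEquality
  open import Relation.Nullary.Decidable using (fromWitness)
  open SliceSums hiding (here)

  -- The least |A| with A ∪ Z ∈ 𝒜, where sets A with A ∪ Z ∉ 𝒜 also compete, at the price
  -- |A| + B, so that the minimum always exists.
  distance : ∀ {n} → ℕ → Collection n → Subset n → ℕ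
  distance B 𝒜 []          = if 𝒜 [] then 0 else B
  distance B 𝒜 (true ∷ Z)  = distance B (𝒜 ∘ (true ∷_)) Z
  distance B 𝒜 (false ∷ Z) =
    distance B (𝒜 ∘ (false ∷_)) Z ⊓ suc (distance B (𝒜 ∘ (true ∷_)) Z)

  -- Meant for the two fibres over the first element: upward closure puts the fibre without it
  -- inside the fibre with it.
  distance-antitone : ∀ {n} B {𝒜 ℬ : Collection n} → (∀ Z → Z ∈𝒜 𝒜 → Z ∈𝒜 ℬ) →
    ∀ Z → distance B ℬ Z ≤ distance B 𝒜 Z
  distance-antitone B {𝒜} 𝒜⊆ℬ [] with 𝒜 [] in eq
  ... | true  rewrite 𝒜⊆ℬ [] eq = z≤n
  distance-antitone B {𝒜} {ℬ} 𝒜⊆ℬ [] | false with ℬ []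
  ... | true  = z≤n
  ... | false = ≤-refl
  distance-antitone B 𝒜⊆ℬ (true ∷ Z)  = distance-antitone B (𝒜⊆ℬ ∘ _) Z
  distance-antitone B 𝒜⊆ℬ (false ∷ Z) =
    ⊓-mono-≤ (distance-antitone B (𝒜⊆ℬ ∘ _) Z) (s≤s (distance-antitone B (𝒜⊆ℬ ∘ _) Z))

  distance-slowlyDecreasing : ∀ {n} B (𝒜 : Collection n) → UpwardClosed n 𝒜 →
    SlowlyDecreasing (distance B 𝒜)
  distance-slowlyDecreasing B 𝒜 up = record { antitone = anti 𝒜 up ; slow = slow′ 𝒜 up }
    where
    fibre : ∀ {n} (𝒜 : Collection (suc n)) b → UpwardClosed (suc n) 𝒜 → UpwardClosed n (𝒜 ∘ (b ∷_))
    fibre 𝒜 b up X Y X⊆Y = up (b ∷ X) (b ∷ Y) (s⊆s X⊆Y)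

    anti : ∀ {n} (𝒜 : Collection n) → UpwardClosed n 𝒜 →
      ∀ {Z Z′} → Z ⋖ Z′ → distance B 𝒜 Z′ ≤ distance B 𝒜 Z
    anti 𝒜 up (_⋖_.here {Z = Z}) =
      ⊓-glb (distance-antitone B (λ X → up (false ∷ X) (true ∷ X) (out⊆ ⊆-refl)) Z) (n≤1+n _)
    anti 𝒜 up (there {b = true} c)  = anti _ (fibre 𝒜 true up) c
    anti 𝒜 up (there {b = false} c) =
      ⊓-mono-≤ (anti _ (fibre 𝒜 false up) c) (s≤s (anti _ (fibre 𝒜 true up) c))

    slow′ : ∀ {n} (𝒜 : Collection n) → UpwardClosed n 𝒜 →
      ∀ {Z Z′} → Z ⋖ Z′ → distance B 𝒜 Z ≤ suc (distance B 𝒜 Z′)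
    -- Adding the missing element at cost 1 is the second branch of the minimum.
    slow′ 𝒜 up _⋖_.here = m⊓n≤n _ _
    slow′ 𝒜 up (there {b = true} c)  = slow′ _ (fibre 𝒜 true up) c
    slow′ 𝒜 up (there {b = false} c) =
      ⊓-mono-≤ (slow′ _ (fibre 𝒜 false up) c) (s≤s (slow′ _ (fibre 𝒜 true up) c))

  ∈⇒distance≡0 : ∀ {n} B (𝒜 : Collection n) Z → Z ∈𝒜 𝒜 → distance B 𝒜 Z ≡ 0
  ∈⇒distance≡0 B 𝒜 []          Z∈ rewrite Z∈ = refl
  ∈⇒distance≡0 B 𝒜 (true ∷ Z)  Z∈ = ∈⇒distance≡0 B _ Z Z∈
  ∈⇒distance≡0 B 𝒜 (false ∷ Z) Z∈ rewrite ∈⇒distance≡0 B (𝒜 ∘ (false ∷_)) Z Z∈ = refl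

  -- A is read off by following the smaller branch of every minimum; the second alternative is a
  -- path that ends by paying B.
  distance-attained : ∀ {n} B (𝒜 : Collection n) Z →
    (∃ λ A → ∣ A ∣ ≤ distance B 𝒜 Z × (A ∪ Z) ∈𝒜 𝒜) ⊎ B ≤ distance B 𝒜 Z
  distance-attained B 𝒜 [] with 𝒜 [] in eq
  ... | true  = inj₁ ([] , z≤n , eq)
  ... | false = inj₂ ≤-refl
  distance-attained B 𝒜 (true ∷ Z) with distance-attained B (𝒜 ∘ (true ∷_)) Z
  ... | inj₁ (A , ∣A∣≤ , A∪Z∈) = inj₁ (false ∷ A , ∣A∣≤ , A∪Z∈)
  ... | inj₂ B≤               = inj₂ B≤
  distance-attained B 𝒜 (false ∷ Z)
    with ≤-total (distance B (𝒜 ∘ (false ∷_)) Z) (suc (distance B (𝒜 ∘ (true ∷_)) Z))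
  ... | inj₁ ≤₀ rewrite m≤n⇒m⊓n≡m ≤₀ with distance-attained B (𝒜 ∘ (false ∷_)) Z
  ...   | inj₁ (A , ∣A∣≤ , A∪Z∈) = inj₁ (false ∷ A , ∣A∣≤ , A∪Z∈)
  ...   | inj₂ B≤               = inj₂ B≤
  distance-attained B 𝒜 (false ∷ Z) | inj₂ ≤₁
    rewrite m≥n⇒m⊓n≡n ≤₁ with distance-attained B (𝒜 ∘ (true ∷_)) Z
  ...   | inj₁ (A , ∣A∣≤ , A∪Z∈) = inj₁ (true ∷ A , s≤s ∣A∣≤ , A∪Z∈)
  ...   | inj₂ B≤               = inj₂ (m≤n⇒m≤1+n B≤)

  -- The choice B = n makes the penalty harmless: whoever pays it can afford ⊤, which has n
  -- elements.
  distance-attained-⊤ : ∀ {n} (𝒜 : Collection n) → ⊤ ∈𝒜 𝒜 → ∀ Z →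
    ∃ λ A → ∣ A ∣ ≤ distance n 𝒜 Z × (A ∪ Z) ∈𝒜 𝒜
  distance-attained-⊤ {n} 𝒜 ⊤∈ Z with distance-attained n 𝒜 Z
  ... | inj₁ attained = attained
  ... | inj₂ n≤ = ⊤ , subst (_≤ distance n 𝒜 Z) (sym (∣⊤∣≡n n)) n≤ , trans (cong 𝒜 (∪-zeroˡ Z)) ⊤∈

  ∈-allSubsets : ∀ {n} (A : Subset n) → A ∈ allSubsets n
  ∈-allSubsets []          = here refl
  ∈-allSubsets (false ∷ A) = ∈-++⁺ˡ (∈-map⁺ (false ∷_) (∈-allSubsets A))
  ∈-allSubsets (true ∷ A)  = ∈-++⁺ʳ _ (∈-map⁺ (true ∷_) (∈-allSubsets A))

  goodZ-intro : ∀ {n} δ (𝒜 : Collection n) Z A →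
    ℕ→ℚ ∣ A ∣ ℚ.< δ ℚ.* ℕ→ℚ n → (A ∪ Z) ∈𝒜 𝒜 → goodZ δ 𝒜 Z ≡ true
  goodZ-intro δ 𝒜 Z A A-small A∪Z∈ = Equivalence.to T-≡ (any⁺ _
    (lose (∈-allSubsets A)
      (Equivalence.from T-∧ (fromWitness A-small , Equivalence.from T-≡ A∪Z∈))))

-- Second moment of the distance and Chebyshev's inequality.

module Concentration where

  open import Data.Bool using (Bool; true; false; if_then_else_; not)
  open import Data.Nat
  open import Data.Nat.Properties
  open import Data.Nat.Tactic.RingSolver using (solve-∀)
  open import Data.Fin.Subset using (Subset)
  open import Function using (_∘_; const)
  open import Relation.Binary.PropositionalEquality
  open SliceSums

  𝟙 : Bool → ℕ
  𝟙 b = if b then 1 else 0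

  -- If d vanishes on a 1/k fraction of the slice then, by Cauchy–Schwarz, so much of its
  -- second moment is variance that the whole second moment is of order k n.
  second-moment : ∀ k n c a s q → c ≤ k * a →
    (c ≡ 0 → q ≡ 0) →
    c * q ≤ s * s + n * (c * c) →
    c * (s * s) + a * (s * s) ≤ c * c * q →
    q ≤ suc k * n * c
  second-moment k n zero a s q c≤ka c≡0⇒q≡0 var cs = ≤-trans (≤-reflexive (c≡0⇒q≡0 refl)) z≤n
  second-moment k n c@(suc _) a s q c≤ka _ var cs = *-cancelˡ-≤ c (begin
    c * q                               ≤⟨ var ⟩
    s * s + n * (c * c)                 ≤⟨ +-monoˡ-≤ _ mean ⟩
    k * (n * (c * c)) + n * (c * c)     ≡⟨ collect k n c ⟩
    c * (suc k * n * c)                 ∎)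
    where
    open ≤-Reasoning
    collect : ∀ k n c → k * (n * (c * c)) + n * (c * c) ≡ c * (suc k * n * c)
    collect = solve-∀
    as² : a * (s * s) ≤ c * (n * (c * c))
    as² = +-cancelˡ-≤ (c * (s * s)) _ _ (begin
      c * (s * s) + a * (s * s)         ≤⟨ cs ⟩
      c * c * q                         ≡⟨ *-assoc c c q ⟩
      c * (c * q)                       ≤⟨ *-monoʳ-≤ c var ⟩
      c * (s * s + n * (c * c))         ≡⟨ *-distribˡ-+ c (s * s) _ ⟩
      c * (s * s) + c * (n * (c * c))   ∎)
    swap : ∀ k c u → k * (c * u) ≡ c * (k * u)
    swap = solve-∀
    mean : s * s ≤ k * (n * (c * c))
    mean = *-cancelˡ-≤ c (begin
      c * (s * s)                       ≤⟨ *-monoˡ-≤ (s * s) c≤ka ⟩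
      k * a * (s * s)                   ≡⟨ *-assoc k a _ ⟩
      k * (a * (s * s))                 ≤⟨ *-monoʳ-≤ k as² ⟩
      k * (c * (n * (c * c)))           ≡⟨ swap k c _ ⟩
      c * (k * (n * (c * c)))           ∎)

  -- Pointwise (c d - s)² is at least s² on 𝒜, where d vanishes, and at least 0 elsewhere. Summed,
  -- this bounds the variance below by the squared mean times the density of 𝒜.
  ∑slice-cauchy-schwarz : ∀ n m (d : Subset n → ℕ) (𝒜 : Subset n → Bool) →
    (∀ Z → 𝒜 Z ≡ true → d Z ≡ 0) →
    let c = slice-size n m ; s = ∑slice n m d in
    c * (s * s) + ∑slice n m (𝟙 ∘ 𝒜) * (s * s) ≤ c * c * ∑slice n m (λ Z → d Z * d Z)
  ∑slice-cauchy-schwarz n m d 𝒜 vanish = +-cancelʳ-≤ (c * (s * s)) _ _ (begin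
    c * (s * s) + a * (s * s) + c * (s * s)
      ≡⟨ rearrange c s a ⟩
    2 * c * s * s + s * s * a
      ≡⟨ cong₂ _+_ (∑slice-* n m (2 * c * s) d) (∑slice-* n m (s * s) (𝟙 ∘ 𝒜)) ⟨
    ∑slice n m (λ Z → 2 * c * s * d Z) + ∑slice n m (λ Z → s * s * 𝟙 (𝒜 Z))
      ≡⟨ ∑slice-+ n m (λ Z → 2 * c * s * d Z) (λ Z → s * s * 𝟙 (𝒜 Z)) ⟨
    ∑slice n m (λ Z → 2 * c * s * d Z + s * s * 𝟙 (𝒜 Z))
      ≤⟨ ∑slice-mono n m pointwise ⟩
    ∑slice n m (λ Z → c * c * (d Z * d Z) + s * s)
      ≡⟨ ∑slice-+ n m (λ Z → c * c * (d Z * d Z)) (const (s * s)) ⟩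
    ∑slice n m (λ Z → c * c * (d Z * d Z)) + ∑slice n m (const (s * s))
      ≡⟨ cong₂ _+_ (∑slice-* n m (c * c) (λ Z → d Z * d Z)) (trans (∑slice-const n m (s * s)) (*-comm (s * s) c)) ⟩
    c * c * ∑slice n m (λ Z → d Z * d Z) + c * (s * s) ∎)
    where
    open ≤-Reasoning
    c = slice-size n m
    s = ∑slice n m d
    a = ∑slice n m (𝟙 ∘ 𝒜)
    rearrange : ∀ c s a → c * (s * s) + a * (s * s) + c * (s * s) ≡ 2 * c * s * s + s * s * a
    rearrange = solve-∀
    pointwise : ∀ Z → 2 * c * s * d Z + s * s * 𝟙 (𝒜 Z) ≤ c * c * (d Z * d Z) + s * s
    pointwise Z with 𝒜 Z in Z∈?
    ... | true  rewrite vanish Z Z∈? = ≤-reflexive (vanished c s)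
      where
      vanished : ∀ c s → 2 * c * s * 0 + s * s * 1 ≡ c * c * 0 + s * s
      vanished = solve-∀
    ... | false = subst₂ _≤_ (lhs c s (d Z)) (rhs c s (d Z)) (2xy≤x²+y² (c * d Z) s)
      where
      lhs : ∀ c s d → 2 * (c * d * s) ≡ 2 * c * s * d + s * s * 0
      lhs = solve-∀
      rhs : ∀ c s d → c * d * (c * d) + s * s ≡ c * c * (d * d) + s * s
      rhs = solve-∀

  ∑slice-second-moment : ∀ k n m d (𝒜 : Subset n → Bool) → SlowlyDecreasing d →
    (∀ Z → 𝒜 Z ≡ true → d Z ≡ 0) →
    slice-size n m ≤ k * ∑slice n m (𝟙 ∘ 𝒜) →
    ∑slice n m (λ Z → d Z * d Z) ≤ suc k * n * slice-size n m
  ∑slice-second-moment k n m d 𝒜 d↘ vanish large = second-moment k n _ (∑slice n m (𝟙 ∘ 𝒜)) (∑slice n m d) _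
    large (slice-size≡0⇒∑slice≡0 n m _) (∑slice-variance n m d d↘) (∑slice-cauchy-schwarz n m d 𝒜 vanish)

  -- Markov's inequality for d²: a bad Z satisfies n² ≤ r² d². In the application r is the
  -- denominator of δ.
  ∑slice-chebyshev : ∀ k n m r (d : Subset n → ℕ) (bad : Subset n → Bool) .{{_ : NonZero n}} →
    (∀ Z → bad Z ≡ true → n ≤ r * d Z) →
    ∑slice n m (λ Z → d Z * d Z) ≤ suc k * n * slice-size n m →
    n * ∑slice n m (𝟙 ∘ bad) ≤ r * r * suc k * slice-size n m
  ∑slice-chebyshev k n m r d bad far moment = *-cancelˡ-≤ n (begin
    n * (n * ∑slice n m (𝟙 ∘ bad))               ≡⟨ *-assoc n n _ ⟨
    n * n * ∑slice n m (𝟙 ∘ bad)                 ≡⟨ ∑slice-* n m (n * n) (𝟙 ∘ bad) ⟨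
    ∑slice n m (λ Z → n * n * 𝟙 (bad Z))         ≤⟨ ∑slice-mono n m pointwise ⟩
    ∑slice n m (λ Z → r * r * (d Z * d Z))       ≡⟨ ∑slice-* n m (r * r) (λ Z → d Z * d Z) ⟩
    r * r * ∑slice n m (λ Z → d Z * d Z)         ≤⟨ *-monoʳ-≤ (r * r) moment ⟩
    r * r * (suc k * n * slice-size n m)         ≡⟨ rearrange r k n (slice-size n m) ⟩
    n * (r * r * suc k * slice-size n m)         ∎)
    where
    open ≤-Reasoning
    rearrange : ∀ r k n c → r * r * (suc k * n * c) ≡ n * (r * r * suc k * c)
    rearrange = solve-∀
    pointwise : ∀ Z → n * n * 𝟙 (bad Z) ≤ r * r * (d Z * d Z)
    pointwise Z with bad Z in eq
    ... | true  = subst₂ _≤_ (sym (*-identityʳ (n * n))) (square r (d Z)) (*-mono-≤ (far Z eq) (far Z eq))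
      where
      square : ∀ r d → r * d * (r * d) ≡ r * r * (d * d)
      square = solve-∀
    ... | false = ≤-trans (≤-reflexive (*-zeroʳ (n * n))) z≤n

  ∑slice-complement : ∀ n m (p : Subset n → Bool) →
    ∑slice n m (𝟙 ∘ p) + ∑slice n m (𝟙 ∘ not ∘ p) ≡ slice-size n m
  ∑slice-complement n m p = trans (sym (∑slice-+ n m _ _)) (∑slice-cong n m (λ Z → one (p Z)))
    where
    one : ∀ b → 𝟙 b + 𝟙 (not b) ≡ 1
    one true  = refl
    one false = refl

-- From filtered lists to slice sums.

module Counting where

  open import Data.Bool as Bool using (Bool; true; false; if_then_else_)
  open import Data.Fin.Subset using (Subset; ∣_∣)
  open import Data.List using (List; []; _∷_; map; filter; length)
  open import Data.List.Properties using (map-++; map-∘)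
  open import Data.Nat
  open import Data.Nat.ListAction using (sum)
  open import Data.Nat.ListAction.Properties using (sum-++)
  open import Data.Nat.Properties
  import Data.Vec as Vec
  open import Function using (_∘_; const)
  open import Relation.Binary.PropositionalEquality
  open import Relation.Nullary using (does)
  open import Relation.Unary using (Pred; Decidable)
  open SliceSums
  open Concentration using (𝟙)

  length-filter : ∀ {a p} {A : Set a} {P : Pred A p} (P? : Decidable P) xs →
    length (filter P? xs) ≡ sum (map (λ x → if does (P? x) then 1 else 0) xs)
  length-filter P? []       = refl
  length-filter P? (x ∷ xs) with does (P? x)
  ... | true  = cong suc (length-filter P? xs)
  ... | false = length-filter P? xs

  -- The inner filter becomes the outer test, the form that `sum-allSubsets` expects of the size
  -- condition.
  length-filter-filter : ∀ {a p q} {A : Set a} {P : Pred A p} {Q : Pred A q}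
    (P? : Decidable P) (Q? : Decidable Q) xs →
    length (filter Q? (filter P? xs))
      ≡ sum (map (λ x → if does (P? x) then 𝟙 (does (Q? x)) else 0) xs)
  length-filter-filter P? Q? []       = refl
  length-filter-filter P? Q? (x ∷ xs) with does (P? x)
  ... | false = length-filter-filter P? Q? xs
  ... | true with does (Q? x)
  ...   | true  = cong suc (length-filter-filter P? Q? xs)
  ...   | false = length-filter-filter P? Q? xs

  sum-map-0 : ∀ {a} {A : Set a} (xs : List A) → sum (map (const 0) xs) ≡ 0
  sum-map-0 []       = refl
  sum-map-0 (x ∷ xs) = sum-map-0 xs

  sum-allSubsets-suc : ∀ n (f : Subset (suc n) → ℕ) → sum (map f (allSubsets (suc n)))
    ≡ sum (map (f ∘ (false Vec.∷_)) (allSubsets n)) + sum (map (f ∘ (true Vec.∷_)) (allSubsets n))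
  sum-allSubsets-suc n f = trans
    (cong sum (map-++ f (map (false Vec.∷_) (allSubsets n)) (map (true Vec.∷_) (allSubsets n))))
    (trans (sum-++ (map f (map (false Vec.∷_) (allSubsets n))) _)
      (cong₂ _+_ (cong sum (sym (map-∘ (allSubsets n)))) (cong sum (sym (map-∘ (allSubsets n))))))

  sum-allSubsets : ∀ n m (f : Subset n → ℕ) →
    sum (map (λ Z → if does (∣ Z ∣ ≟ m) then f Z else 0) (allSubsets n)) ≡ ∑slice n m f
  sum-allSubsets zero    zero    f = +-identityʳ _
  sum-allSubsets zero    (suc m) f = refl
  sum-allSubsets (suc n) zero    f = trans (sum-allSubsets-suc n _)
    -- At level 0 the subsets containing the first element have the wrong size, so their half of the
    -- list sums to 0.
    (trans (cong₂ _+_ (sum-allSubsets n 0 _) (sum-map-0 (allSubsets n))) (+-identityʳ _))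
  sum-allSubsets (suc n) (suc m) f = trans (sum-allSubsets-suc n _)
    (cong₂ _+_ (sum-allSubsets n (suc m) _) (sum-allSubsets n m _))

  length-subsetsOfSize : ∀ n m → length (subsetsOfSize n m) ≡ slice-size n m
  length-subsetsOfSize n m =
    trans (length-filter (λ Z → ∣ Z ∣ ≟ m) (allSubsets n)) (sum-allSubsets n m (const 1))

  goodCount≡∑slice : ∀ n m δ 𝒜 → goodCount n m δ 𝒜 ≡ ∑slice n m (𝟙 ∘ goodZ δ 𝒜)
  goodCount≡∑slice n m δ 𝒜 =
    trans (length-filter-filter (λ Z → ∣ Z ∣ ≟ m) (λ Z → goodZ δ 𝒜 Z Bool.≟ true) (allSubsets n))
      (trans (sum-allSubsets n m _) (∑slice-cong n m (λ Z → does-≟-true (goodZ δ 𝒜 Z))))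
    where
    does-≟-true : ∀ b → 𝟙 (does (b Bool.≟ true)) ≡ 𝟙 b
    does-≟-true true  = refl
    does-≟-true false = refl

-- From rational inequalities to natural ones.

module Rationals where

  open import Data.Integer as ℤ using (-[1+_]; +<+; +≤+) renaming (+_ to ofℕ)
  import Data.Integer.Properties as ℤ
  import Data.Nat as ℕ
  import Data.Nat.Properties as ℕ
  open import Data.Rational
  open import Data.Rational.Properties
  open import Data.Rational.Unnormalised as ℚᵘ using (mkℚᵘ; *≡*; *<*; *≤*)
  import Data.Rational.Unnormalised.Properties as ℚᵘ
  open import Relation.Binary.PropositionalEquality

  toℚᵘ-ℕ→ℚ : ∀ x → toℚᵘ (ℕ→ℚ x) ℚᵘ.≃ mkℚᵘ (ofℕ x) 0
  toℚᵘ-ℕ→ℚ x = toℚᵘ-fromℚᵘ (mkℚᵘ (ofℕ x) 0)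

  toℚᵘ-*-ℕ→ℚ : ∀ δ n → toℚᵘ (δ * ℕ→ℚ n) ℚᵘ.≃ toℚᵘ δ ℚᵘ.* mkℚᵘ (ofℕ n) 0
  toℚᵘ-*-ℕ→ℚ δ n = ℚᵘ.≃-trans (toℚᵘ-homo-* δ (ℕ→ℚ n)) (ℚᵘ.*-congˡ {toℚᵘ δ} (toℚᵘ-ℕ→ℚ n))

  ℕ→ℚ-+ : ∀ x y → ℕ→ℚ (x ℕ.+ y) ≡ ℕ→ℚ x + ℕ→ℚ y
  ℕ→ℚ-+ x y = toℚᵘ-injective (ℚᵘ.≃-trans (toℚᵘ-ℕ→ℚ (x ℕ.+ y)) (ℚᵘ.≃-trans
    (*≡* (cong (ℤ._* ofℕ 1) (trans (ℤ.pos-+ x y) (sym (cong₂ ℤ._+_ (ℤ.*-identityʳ (ofℕ x)) (ℤ.*-identityʳ (ofℕ y)))))))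
    (ℚᵘ.≃-sym (ℚᵘ.≃-trans (toℚᵘ-homo-+ (ℕ→ℚ x) (ℕ→ℚ y)) (ℚᵘ.+-cong (toℚᵘ-ℕ→ℚ x) (toℚᵘ-ℕ→ℚ y))))))

  private
    scaleˡ : ∀ x r → ofℕ x ℤ.* ofℕ (ℕ.suc r ℕ.* 1) ≡ ofℕ (ℕ.suc r ℕ.* x)
    scaleˡ x r = trans (sym (ℤ.pos-* x (ℕ.suc r ℕ.* 1)))
      (cong ofℕ (trans (cong (x ℕ.*_) (ℕ.*-identityʳ (ℕ.suc r))) (ℕ.*-comm x (ℕ.suc r))))

    scaleʳ : ∀ p n → ofℕ (ℕ.suc p) ℤ.* ofℕ n ℤ.* ofℕ 1 ≡ ofℕ (ℕ.suc p ℕ.* n)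
    scaleʳ p n = trans (ℤ.*-identityʳ (ofℕ (ℕ.suc p) ℤ.* ofℕ n)) (sym (ℤ.pos-* (ℕ.suc p) n))

  -- A positive rational has numerator at least 1, hence is at least the reciprocal of its
  -- denominator. This is why δ and ε enter the counting through `↧ₙ` alone.
  ↧ₙδ*x<n⇒x<δ*n : ∀ δ → 0ℚ < δ → ∀ x n → ↧ₙ δ ℕ.* x ℕ.< n → ℕ→ℚ x < δ * ℕ→ℚ n
  ↧ₙδ*x<n⇒x<δ*n δ@(mkℚ (ofℕ (ℕ.suc p)) r _) 0<δ x n rx<n = toℚᵘ-cancel-<
    (ℚᵘ.<-respˡ-≃ (ℚᵘ.≃-sym (toℚᵘ-ℕ→ℚ x)) (ℚᵘ.<-respʳ-≃ (ℚᵘ.≃-sym (toℚᵘ-*-ℕ→ℚ δ n))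
      (*<* (subst₂ ℤ._<_ (sym (scaleˡ x r)) (sym (scaleʳ p n))
        (+<+ (ℕ.<-≤-trans rx<n (ℕ.m≤n*m n (ℕ.suc p))))))))
  ↧ₙδ*x<n⇒x<δ*n (mkℚ (ofℕ ℕ.zero) _ _) (*<* (+<+ ()))
  ↧ₙδ*x<n⇒x<δ*n (mkℚ -[1+ _ ] _ _) (*<* ())

  ↧ₙε*x≤n⇒x≤ε*n : ∀ ε → 0ℚ < ε → ∀ x n → ↧ₙ ε ℕ.* x ℕ.≤ n → ℕ→ℚ x ≤ ε * ℕ→ℚ n
  ↧ₙε*x≤n⇒x≤ε*n ε@(mkℚ (ofℕ (ℕ.suc p)) r _) 0<ε x n rx≤n = toℚᵘ-cancel-≤
    (ℚᵘ.≤-respˡ-≃ (ℚᵘ.≃-sym (toℚᵘ-ℕ→ℚ x)) (ℚᵘ.≤-respʳ-≃ (ℚᵘ.≃-sym (toℚᵘ-*-ℕ→ℚ ε n))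
      (*≤* (subst₂ ℤ._≤_ (sym (scaleˡ x r)) (sym (scaleʳ p n))
        (+≤+ (ℕ.≤-trans rx≤n (ℕ.m≤n*m n (ℕ.suc p))))))))
  ↧ₙε*x≤n⇒x≤ε*n (mkℚ (ofℕ ℕ.zero) _ _) (*<* (+<+ ()))
  ↧ₙε*x≤n⇒x≤ε*n (mkℚ -[1+ _ ] _ _) (*<* ())

  few-exceptions⇒most : ∀ ε → 0ℚ < ε → ∀ good bad total →
    good ℕ.+ bad ≡ total → ↧ₙ ε ℕ.* bad ℕ.≤ total → (1ℚ - ε) * ℕ→ℚ total ≤ ℕ→ℚ good
  few-exceptions⇒most ε 0<ε good bad total sum≡ few = begin
    (1ℚ - ε) * ℕ→ℚ total
      ≡⟨ *-distribʳ-+ (ℕ→ℚ total) 1ℚ (- ε) ⟩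
    1ℚ * ℕ→ℚ total + - ε * ℕ→ℚ total
      ≡⟨ cong₂ _+_ (*-identityˡ (ℕ→ℚ total)) (sym (neg-distribˡ-* ε (ℕ→ℚ total))) ⟩
    ℕ→ℚ total - ε * ℕ→ℚ total
      ≤⟨ +-monoʳ-≤ (ℕ→ℚ total) (neg-antimono-≤ (↧ₙε*x≤n⇒x≤ε*n ε 0<ε bad total few)) ⟩
    ℕ→ℚ total - ℕ→ℚ bad
      ≡⟨ cong (_- ℕ→ℚ bad) (trans (cong ℕ→ℚ (sym sum≡)) (ℕ→ℚ-+ good bad)) ⟩
    ℕ→ℚ good + ℕ→ℚ bad - ℕ→ℚ bad
      ≡⟨ +-assoc (ℕ→ℚ good) (ℕ→ℚ bad) (- ℕ→ℚ bad) ⟩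
    ℕ→ℚ good + (ℕ→ℚ bad - ℕ→ℚ bad)
      ≡⟨ cong (λ q → ℕ→ℚ good + q) (+-inverseʳ (ℕ→ℚ bad)) ⟩
    ℕ→ℚ good + 0ℚ
      ≡⟨ +-identityʳ (ℕ→ℚ good) ⟩
    ℕ→ℚ good ∎
    where open ≤-Reasoning

-- Bounding the number of bad m-sets.

module BadSets where

  open import Data.Bool using (true; not)
  open import Data.Fin.Subset using (∣_∣; ⊤)
  open import Data.Fin.Subset.Properties using (⊆⊤)
  import Data.Fin as Fin
  open import Data.Nat
  open import Data.Nat.Properties
  open import Data.Product using (_,_)
  open import Data.Rational as ℚ using (ℚ; 0ℚ; ↧ₙ_)
  open import Function using (_∘_; case_of_)
  open import Relation.Binary.PropositionalEquality
  open SliceSums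
  open Equipartitions
  open Distance
  open Concentration
  open Rationals

  -- Any colouring will do, and k ≥ 1 provides a constant one; ⊤ contains whichever piece lies in 𝒜.
  ⊤∈ : ∀ {k N} (𝒜 : Collection N) → 1 ≤ k → KLarge k N 𝒜 → UpwardClosed N 𝒜 → ⊤ ∈𝒜 𝒜
  ⊤∈ 𝒜 (s≤s _) large up with large (λ _ → Fin.zero)
  ... | i , piece∈ = up _ ⊤ ⊆⊤ piece∈

  near⇒good : ∀ {N} δ → 0ℚ ℚ.< δ → (𝒜 : Collection N) → ⊤ ∈𝒜 𝒜 →
    ∀ Z → ↧ₙ δ * distance N 𝒜 Z < N → goodZ δ 𝒜 Z ≡ true
  near⇒good {N} δ 0<δ 𝒜 top Z near =
    let A , ∣A∣≤ , A∪Z∈ = distance-attained-⊤ 𝒜 top Z in goodZ-intro δ 𝒜 Z A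
    (↧ₙδ*x<n⇒x<δ*n δ 0<δ ∣ A ∣ N (≤-<-trans (*-monoʳ-≤ (↧ₙ δ) ∣A∣≤) near)) A∪Z∈

  not-good⇒far : ∀ {N} δ → 0ℚ ℚ.< δ → (𝒜 : Collection N) → ⊤ ∈𝒜 𝒜 →
    ∀ Z → not (goodZ δ 𝒜 Z) ≡ true → N ≤ ↧ₙ δ * distance N 𝒜 Z
  not-good⇒far δ 0<δ 𝒜 top Z not-good = ≮⇒≥ λ near →
    case trans (sym not-good) (cong not (near⇒good δ 0<δ 𝒜 top Z near)) of λ ()

  large-fraction : ∀ k m (𝒜 : Collection (k * m)) → 1 ≤ k → KLarge k (k * m) 𝒜 →
    slice-size (k * m) m ≤ k * ∑slice (k * m) m (𝟙 ∘ 𝒜)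
  large-fraction k m 𝒜 1≤k large = equipartition-average k m (𝟙 ∘ 𝒜) 1≤k some-piece
    where
    some-piece : ∀ f → _
    some-piece f with large f
    ... | i , piece∈ = ≤-trans (≤-reflexive (cong 𝟙 (sym piece∈))) (term≤sum (λ i → 𝟙 (𝒜 (piece f i))) i)

  -- The Chebyshev constant: distance at least N / `↧ₙ δ` on bad sets and second moment at most (k +
  -- 1) N make the bad fraction at most `inverse-scale k δ` / N.
  inverse-scale : ℕ → ℚ → ℕ
  inverse-scale k δ = ↧ₙ δ * ↧ₙ δ * suc k

  bad-count : ∀ k m δ (𝒜 : Collection (k * m)) → 1 ≤ k → 0ℚ ℚ.< δ →
    KLarge k (k * m) 𝒜 → UpwardClosed (k * m) 𝒜 → .{{_ : NonZero (k * m)}} →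
    k * m * ∑slice (k * m) m (𝟙 ∘ not ∘ goodZ δ 𝒜) ≤ inverse-scale k δ * slice-size (k * m) m
  bad-count k m δ 𝒜 1≤k 0<δ large up = ∑slice-chebyshev k N m (↧ₙ δ) d (not ∘ goodZ δ 𝒜)
    (not-good⇒far δ 0<δ 𝒜 (⊤∈ 𝒜 1≤k large up))
    (∑slice-second-moment k N m d 𝒜 (distance-slowlyDecreasing N 𝒜 up) (∈⇒distance≡0 N 𝒜)
      (large-fraction k m 𝒜 1≤k large))
    where
    N = k * m
    d = distance N 𝒜

  -- From this N on, the bound on the bad fraction is at most 1 / `↧ₙ ε`, hence at most ε.
  threshold : ℕ → ℚ → ℚ → ℕ
  threshold k δ ε = inverse-scale k δ * ↧ₙ ε

  divide : ∀ u t n b c .{{_ : NonZero u}} → u * t ≤ n → n * b ≤ u * c → t * b ≤ c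
  divide u t n b c ut≤n nb≤uc = *-cancelˡ-≤ u (begin
    u * (t * b)   ≡⟨ *-assoc u t b ⟨
    u * t * b     ≤⟨ *-monoˡ-≤ b ut≤n ⟩
    n * b         ≤⟨ nb≤uc ⟩
    u * c         ∎)
    where open ≤-Reasoning

  few-bad : ∀ k m δ ε (𝒜 : Collection (k * m)) → 1 ≤ k → 0ℚ ℚ.< δ →
    KLarge k (k * m) 𝒜 → UpwardClosed (k * m) 𝒜 → threshold k δ ε ≤ k * m →
    ↧ₙ ε * ∑slice (k * m) m (𝟙 ∘ not ∘ goodZ δ 𝒜) ≤ slice-size (k * m) m
  few-bad k m δ ε 𝒜 1≤k 0<δ large up N≥ =
    divide (inverse-scale k δ) (↧ₙ ε) (k * m) _ _ {{u≢0}} N≥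
      -- The threshold is positive, which rules out N = 0.
      (bad-count k m δ 𝒜 1≤k 0<δ large up {{>-nonZero (<-≤-trans (>-nonZero⁻¹ _ {{t≢0}}) N≥)}})
    where
    u≢0 : NonZero (inverse-scale k δ)
    u≢0 = m*n≢0 (↧ₙ δ * ↧ₙ δ) (suc k) {{m*n≢0 (↧ₙ δ) (↧ₙ δ)}}
    t≢0 : NonZero (threshold k δ ε)
    t≢0 = m*n≢0 (inverse-scale k δ) (↧ₙ ε) {{u≢0}}

-- The probability bound.

open import Data.Bool using (not)
open import Data.Nat using (ℕ; _≥_; _+_; _*_)
open import Data.List using (length)
open import Data.Product using (∃; _,_)
import Data.Rational
open import Data.Rational using (ℚ; 0ℚ; 1ℚ; _<_; _≤_; _-_; ↧ₙ_)
open import Function using (_∘_)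
open import Relation.Binary.PropositionalEquality using (_≡_; refl; sym; trans; subst; cong)
open SliceSums
open Concentration
open Counting
open Rationals
open BadSets

theorem2p9 : (k : ℕ) → k ≥ 1 → (δ : ℚ) → 0ℚ < δ → (ε : ℚ) → 0ℚ < ε →
    ∃ λ (N₀ : ℕ) → (N : ℕ) → N ≥ N₀ → (m : ℕ) → N ≡ k * m →
    (𝒜 : Collection N) → KLarge k N 𝒜 → UpwardClosed N 𝒜 →
    (1ℚ - ε) Data.Rational.* ℕ→ℚ (length (subsetsOfSize N m))
    ≤ ℕ→ℚ (goodCount N m δ 𝒜)
theorem2p9 k k≥1 δ 0<δ ε 0<ε = threshold k δ ε , conclusion
  where
  conclusion : ∀ N → N ≥ threshold k δ ε → ∀ m → N ≡ k * m →
    (𝒜 : Collection N) → KLarge k N 𝒜 → UpwardClosed N 𝒜 →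
    (1ℚ - ε) Data.Rational.* ℕ→ℚ (length (subsetsOfSize N m)) ≤ ℕ→ℚ (goodCount N m δ 𝒜)
  conclusion N N≥ m refl 𝒜 large up = few-exceptions⇒most ε 0<ε
    (goodCount N m δ 𝒜) (∑slice N m (𝟙 ∘ not ∘ goodZ δ 𝒜)) (length (subsetsOfSize N m))
    (trans (cong (λ g → g + ∑slice N m (𝟙 ∘ not ∘ goodZ δ 𝒜)) (goodCount≡∑slice N m δ 𝒜))
      (trans (∑slice-complement N m (goodZ δ 𝒜)) (sym (length-subsetsOfSize N m))))
    (subst (λ c → ↧ₙ ε * ∑slice N m (𝟙 ∘ not ∘ goodZ δ 𝒜) Data.Nat.≤ c) (sym (length-subsetsOfSize N m))
      (few-bad k m δ ε 𝒜 k≥1 0<δ large up N≥))
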